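{- Let $\mathrm{L}$ be a relational language, $\mathcal{M}$ an $\mathrm{L}$-structure and $\mathfrak{N}=\{\mathcal{N}_a\}_{a\in\mathcal{M}}$ a collection of $\mathrm{L}$-structures indexed by $\mathcal{M}$. Assume that for every sentence $\phi\in\mathrm{L}$, the set $\{a\in\mathcal{M}\mid\mathcal{N}_a\models\phi\}$ is $\emptyset$-definable in $\mathcal{M}$. Assume also: - $(QE)_\mathfrak{N}$: for each $\mathrm{L}$-formula $\phi(\bar{x})$ there are $k\in\mathbb{N}$ and quantifier-free $\mathrm{L}$-formulas $\phi_i(\bar{x})$, $i<k$, such that for all models $\mathcal{N}$ of $\mathrm{Th}(\mathfrak{N})$ there is $i<k$ with $\mathcal{N}\models\forall\bar{x}\ \phi(\bar{x})\leftrightarrow\phi_i(\bar{x})$; - $(QE)_\mathcal{M}$: $\mathcal{M}$ eliminates quantifiers in $\mathrm{L}$. Then the lexicographic product $\mathcal{M}[\mathfrak{N}^s]^{\mathbb{U}}$ eliminates quantifiers in $\mathrm{L}_{\mathbb{U},s}$.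
   Context: $\mathrm{Th}(\mathfrak{N})$ is the common theory of all the $\mathcal{N}_a$, $a\in\mathcal{M}$. The (generalised) lexicographic product $\mathcal{M}[\mathfrak{N}^s]^{\mathbb{U}}$ is a structure in the language $\mathrm{L}_{\mathbb{U},s}=\mathrm{L}\cup\{R^{\mathbb{U}}\}_{R\in\mathrm{L}}\cup\{s\}$, where the $R^{\mathbb{U}}$ are new unary predicates and $s$ is a binary predicate. Its base set is $\bigcup_{a\in\mathcal{M}}\{a\}\times\mathcal{N}_a$, and: - $s:=\{((a,b),(a,b'))\mid a\in\mathcal{M},\ b,b'\in\mathcal{N}_a\}$; - for an $n$-ary $R\in\mathrm{L}$, $R$ is interpreted as $\{((a,b_1),\dots,(a,b_n))\mid a\in\mathcal{M},\ \mathcal{N}_a\models R(b_1,\dots,b_n)\}\cup\{((a_1,b_1),\dots,(a_n,b_n))\mid a_i\ne a_j\text{ for some }i<j,\text{ and }\mathcal{M}\models R(a_1,\dots,a_n)\}$; - for an $n$-ary $R\in\mathrm{L}$, $R^{\mathbb{U}}:=\{(a,b)\mid\mathcal{M}\models R(a,\dots,a)\}$ ($n$ times $a$). -}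

module Defs where

open import Data.Empty.Polymorphic using (⊥)
open import Data.Fin using (Fin; _<_)
open import Data.Nat using (ℕ; suc)
open import Data.Product using (Σ; Σ-syntax; ∃-syntax; _×_; _,_; proj₁)
open import Data.Sum using (_⊎_)
open import Data.Vec using (Vec; []; _∷_; lookup; map; replicate)
open import Function.Bundles using (_⇔_)
open import Level using (Level; _⊔_) renaming (suc to lsuc)
open import Relation.Binary.PropositionalEquality using (_≡_; _≢_)
open import Relation.Unary using (Pred)

private
  variable
    ℓ c p : Level

record Language (ℓ : Level) : Set (lsuc ℓ) where
  field
    Symbol : Set ℓ
    arity  : Symbol → ℕ

open Language public

-- Structures are not required to be nonempty.
record Structure (L : Language ℓ) (c : Level) : Set (ℓ ⊔ lsuc c) where
  field
    Carrier : Set c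
    rel     : (R : Symbol L) → Vec Carrier (arity L R) → Set c

open Structure public

-- Formulas of first-order logic with equality, with free variables among n
-- de Bruijn variables. The only terms of a relational language are variables.
-- Since ⊥′ is a formula, there are quantifier-free sentences in any language.
data Formula (L : Language ℓ) (n : ℕ) : Set ℓ where
  ⊥′             : Formula L n
  _≈′_           : Fin n → Fin n → Formula L n
  rel′           : (R : Symbol L) → Vec (Fin n) (arity L R) → Formula L n
  _∧′_ _∨′_ _⇒′_ : Formula L n → Formula L n → Formula L n
  ∃′_ ∀′_        : Formula L (suc n) → Formula L n

infix  8 _≈′_
infixr 7 _∧′_
infixr 6 _∨′_
infixr 5 _⇒′_

Sentence : Language ℓ → Set ℓ
Sentence L = Formula L 0

data QuantifierFree {L : Language ℓ} {n : ℕ} : Formula L n → Set ℓ where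
  qf-⊥   : QuantifierFree ⊥′
  qf-≈   : ∀ x y → QuantifierFree (x ≈′ y)
  qf-rel : ∀ R xs → QuantifierFree (rel′ R xs)
  qf-∧   : ∀ {φ ψ} → QuantifierFree φ → QuantifierFree ψ → QuantifierFree (φ ∧′ ψ)
  qf-∨   : ∀ {φ ψ} → QuantifierFree φ → QuantifierFree ψ → QuantifierFree (φ ∨′ ψ)
  qf-⇒   : ∀ {φ ψ} → QuantifierFree φ → QuantifierFree ψ → QuantifierFree (φ ⇒′ ψ)

infix 4 _⊨_[_] _⊨_

-- The variable bound by a quantifier is the head of the extended valuation.
_⊨_[_] : {L : Language ℓ} (M : Structure L c) {n : ℕ} →
         Formula L n → Vec (Carrier M) n → Set c
M ⊨ ⊥′        [ v ] = ⊥
M ⊨ x ≈′ y    [ v ] = lookup v x ≡ lookup v y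
M ⊨ rel′ R xs [ v ] = rel M R (map (lookup v) xs)
M ⊨ φ ∧′ ψ    [ v ] = (M ⊨ φ [ v ]) × (M ⊨ ψ [ v ])
M ⊨ φ ∨′ ψ    [ v ] = (M ⊨ φ [ v ]) ⊎ (M ⊨ ψ [ v ])
M ⊨ φ ⇒′ ψ    [ v ] = (M ⊨ φ [ v ]) → (M ⊨ ψ [ v ])
M ⊨ ∃′ φ      [ v ] = Σ[ a ∈ Carrier M ] (M ⊨ φ [ a ∷ v ])
M ⊨ ∀′ φ      [ v ] = (a : Carrier M) → M ⊨ φ [ a ∷ v ]

_⊨_ : {L : Language ℓ} → Structure L c → Sentence L → Set c
M ⊨ φ = M ⊨ φ [ [] ]

∅-Definable : {L : Language ℓ} (M : Structure L c) → Pred (Carrier M) p → Set (ℓ ⊔ c ⊔ p)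
∅-Definable {L = L} M P = Σ[ φ ∈ Formula L 1 ] (∀ a → P a ⇔ (M ⊨ φ [ a ∷ [] ]))

-- M ⊨ ∀ x̄ (φ(x̄) ↔ ψ(x̄))
EquivalentIn : {L : Language ℓ} (M : Structure L c) {n : ℕ} → (φ ψ : Formula L n) → Set c
EquivalentIn M {n} φ ψ = (v : Vec (Carrier M) n) → (M ⊨ φ [ v ]) ⇔ (M ⊨ ψ [ v ])

EliminatesQuantifiers : {L : Language ℓ} → Structure L c → Set (ℓ ⊔ c)
EliminatesQuantifiers {L = L} M =
  ∀ {n} (φ : Formula L n) → Σ[ ψ ∈ Formula L n ] (QuantifierFree ψ × EquivalentIn M φ ψ)

IsModel : {L : Language ℓ} → Structure L c → Pred (Sentence L) p → Set (ℓ ⊔ c ⊔ p)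
IsModel N T = ∀ σ → T σ → N ⊨ σ

Th : {L : Language ℓ} {I : Set c} → (I → Structure L c) → Pred (Sentence L) c
Th 𝔑 σ = ∀ a → 𝔑 a ⊨ σ

-- The models range over all structures in the universe of the 𝔑 a.
UniformlyEliminatesQuantifiers : {L : Language ℓ} {I : Set c} → (I → Structure L c) → Set (ℓ ⊔ lsuc c)
UniformlyEliminatesQuantifiers {c = c} {L = L} 𝔑 =
  ∀ {n} (φ : Formula L n) →
  Σ[ k ∈ ℕ ] Σ[ φs ∈ (Fin k → Formula L n) ]
    ((∀ i → QuantifierFree (φs i)) ×
     ((N : Structure L c) → IsModel N (Th 𝔑) → ∃[ i ] EquivalentIn N φ (φs i)))

data LexSymbol (S : Set ℓ) : Set ℓ where
  base : S → LexSymbol S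
  _ᵁ   : S → LexSymbol S
  s    : LexSymbol S

LexLanguage : Language ℓ → Language ℓ
LexLanguage L .Symbol         = LexSymbol (Symbol L)
LexLanguage L .arity (base R) = arity L R
LexLanguage L .arity (R ᵁ)    = 1
LexLanguage L .arity s        = 2

module _ {L : Language ℓ} (M : Structure L c) (𝔑 : Carrier M → Structure L c) where

  LexCarrier : Set c
  LexCarrier = Σ[ a ∈ Carrier M ] Carrier (𝔑 a)

  LexRel : (R : LexSymbol (Symbol L)) → Vec LexCarrier (arity (LexLanguage L) R) → Set c
  LexRel (base R) w =
      (Σ[ a ∈ Carrier M ] Σ[ bs ∈ Vec (Carrier (𝔑 a)) (arity L R) ]
         (w ≡ map (a ,_) bs × rel (𝔑 a) R bs))
    ⊎ ((∃[ i ] ∃[ j ] (i < j × proj₁ (lookup w i) ≢ proj₁ (lookup w j)))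
         × rel M R (map proj₁ w))
  LexRel (R ᵁ) ((a , _) ∷ [])           = rel M R (replicate (arity L R) a)
  LexRel s     ((a , _) ∷ (a′ , _) ∷ []) = a ≡ a′

  LexProduct : Structure (LexLanguage L) c
  LexProduct .Carrier = LexCarrier
  LexProduct .rel     = LexRel

{-# OPTIONS --safe #-}
module Submission where

-- It suffices to eliminate one quantifier ∃x from a quantifier-free ψ(x, v̄),
-- where x = (a , b). Fix a and v̄, and let b vary. An atom of ψ that holds x
-- either speaks about the fibre 𝔑 a only, or is decided by a and the first
-- coordinates of v̄; the other atoms are decided by v̄. Hence ψ((a , b), v̄) is
-- equivalent to an L-formula χ(b, l̄) in 𝔑 a, where l̄ are the parameters in the
-- fibre over a, and χ ranges over finitely many formulas as a and v̄ vary.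
-- If a is the first coordinate of some v̄ i, then (QE)_𝔑 makes ∃b χ(b, l̄)
-- quantifier-free in 𝔑 a, and which of the finitely many candidates applies is
-- decided by sentences true in 𝔑 a, that is, by formulas about a in M. Otherwise
-- l̄ is empty, ∃b χ(b) is itself a sentence, and what remains is a statement of
-- the form ∃a Θ(a, ā) in M, to which (QE)_M applies. Quantifier-free formulas on
-- first coordinates translate back by means of s and R ᵁ.

open import Defs
open import Axiom.ExcludedMiddle using (ExcludedMiddle)
open import Data.Bool using (Bool; true; false; if_then_else_)
open import Data.Empty.Polymorphic using (⊥; ⊥-elim)
open import Data.Fin using (Fin; zero; suc; _<_)
open import Data.Fin.Properties using (<-cmp; ¬∀⟶∃¬)
open import Data.Maybe as Maybe using (Maybe; just; nothing)
open import Data.Nat using (ℕ; zero; suc)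
open import Data.Product using (Σ-syntax; ∃-syntax; _×_; _,_; proj₁; proj₂)
open import Data.Product.Function.NonDependent.Propositional using (_×-⇔_)
open import Data.Sum using (_⊎_; inj₁; inj₂)
open import Data.Sum.Function.Propositional using (_⊎-⇔_)
open import Data.Vec using (Vec; []; _∷_; allFin; head; lookup; map; replicate; tabulate)
open import Data.Vec.Properties
  using (lookup-allFin; lookup-map; lookup-replicate; lookup∘tabulate; map-cong;
         map-lookup-allFin; map-replicate; map-∘; ∷-injective; ∷-injectiveˡ; ∷-injectiveʳ)
open import Function using (_∘_; case_of_)
open import Function.Bundles using (_⇔_; mk⇔; Equivalence)
open import Function.Construct.Composition using (_⇔-∘_)
open import Function.Construct.Identity using (⇔-id)
open import Function.Construct.Symmetry using (⇔-sym)
open import Function.Related.TypeIsomorphisms using (→-cong-⇔)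
open import Level using (Level; _⊔_; lift; lower) renaming (suc to lsuc)
open import Relation.Binary.Definitions using (tri<; tri≈; tri>)
open import Relation.Binary.PropositionalEquality
  using (_≡_; _≢_; refl; sym; trans; cong; cong₂; subst; subst₂)
open import Relation.Nullary using (¬_; Dec; yes; no; does; contradiction; decidable-stable)
open import Relation.Unary using (Pred)

open Equivalence using (to; from)

private
  variable
    ℓ c d t x y z : Level
    k m n : ℕ

-- Auxiliary formulas and vectors

⊤′ : {L : Language ℓ} → Formula L n
⊤′ = ⊥′ ⇒′ ⊥′

truth : {L : Language ℓ} → Bool → Formula L n
truth b = if b then ⊤′ else ⊥′

-- Universal closure. It turns the equivalence of two formulas in a fibre into a sentence, and the
-- points of `M` whose fibre satisfies that sentence form a definable set.
close : {L : Language ℓ} → Formula L n → Sentence L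
close {n = zero}  φ = φ
close {n = suc n} φ = close (∀′ φ)

close-⇔ : {L : Language ℓ} (A : Structure L c) (φ : Formula L n) →
          (A ⊨ close φ) ⇔ (∀ v → A ⊨ φ [ v ])
close-⇔ {n = zero}  A φ = mk⇔ (λ h → λ { [] → h }) (λ h → h [])
close-⇔ {n = suc n} A φ =
  mk⇔ (λ h → λ { (a ∷ v) → h v a }) (λ h v a → h (a ∷ v)) ⇔-∘ close-⇔ A (∀′ φ)

map-lookup-map : {A : Set x} {B : Set y} (f : A → B) (us : Vec A n) (xs : Vec (Fin n) k) →
                 map (lookup (map f us)) xs ≡ map f (map (lookup us) xs)
map-lookup-map f us xs = trans (map-cong (λ i → lookup-map i f us) xs) (map-∘ f (lookup us) xs)

map-constant : {A : Set x} {B : Set y} (f : A → B) (xs : Vec A k) {b : B} →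
               (∀ i → f (lookup xs i) ≡ b) → map f xs ≡ replicate k b
map-constant f []       h = refl
map-constant f (x ∷ xs) h = cong₂ _∷_ (h zero) (map-constant f xs (h ∘ suc))

empty-or-inhabited : ∀ k → k ≡ 0 ⊎ Fin k
empty-or-inhabited zero    = inj₁ refl
empty-or-inhabited (suc k) = inj₂ zero

empty-unique : {A : Set x} → k ≡ 0 → (u v : Vec A k) → u ≡ v
empty-unique refl [] [] = refl

-- Boolean classes of predicates and finitely valued functions

record BooleanClass {Θ : Set t} (𝒟 : Pred Θ c → Set d) : Set (t ⊔ lsuc c ⊔ d) where
  field
    resp   : ∀ {P Q} → (∀ θ → P θ ⇔ Q θ) → 𝒟 P → 𝒟 Q
    falsum : 𝒟 (λ _ → ⊥)
    _and_  : ∀ {P Q} → 𝒟 P → 𝒟 Q → 𝒟 (λ θ → P θ × Q θ)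
    _or_   : ∀ {P Q} → 𝒟 P → 𝒟 Q → 𝒟 (λ θ → P θ ⊎ Q θ)
    _imp_  : ∀ {P Q} → 𝒟 P → 𝒟 Q → 𝒟 (λ θ → P θ → Q θ)

  neg : ∀ {P} → 𝒟 P → 𝒟 (λ θ → ¬ P θ)
  neg p = resp (λ θ → mk⇔ (λ h a → lower (h a)) (λ h a → lift (h a))) (p imp falsum)

  all-Fin : {P : Fin k → Pred Θ c} → (∀ i → 𝒟 (P i)) → 𝒟 (λ θ → ∀ i → P i θ)
  all-Fin {k = zero}  p = resp (λ θ → mk⇔ (λ _ ()) (λ _ h → h)) (falsum imp falsum)
  all-Fin {k = suc k} p =
    resp (λ θ → mk⇔ (λ { (h , hs) → λ { zero → h ; (suc i) → hs i } })
                    (λ h → h zero , λ i → h (suc i)))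
         (p zero and all-Fin (p ∘ suc))

  any-Fin : {P : Fin k → Pred Θ c} → (∀ i → 𝒟 (P i)) → 𝒟 (λ θ → ∃[ i ] P i θ)
  any-Fin {k = zero}  p = resp (λ θ → mk⇔ ⊥-elim (λ ())) falsum
  any-Fin {k = suc k} p =
    resp (λ θ → mk⇔ (λ { (inj₁ h) → zero , h ; (inj₂ (i , h)) → suc i , h })
                    (λ { (zero , h) → inj₁ h ; (suc i , h) → inj₂ (i , h) }))
         (p zero or any-Fin (p ∘ suc))

  -- Stands for "f takes finitely many values and its fibres are in 𝒟". In this
  -- form no enumeration of the values is needed.
  Simple : {Y : Set y} → (Θ → Y) → Set (t ⊔ lsuc c ⊔ d ⊔ y)
  Simple {Y = Y} f = (P : Y → Pred Θ c) → (∀ y → 𝒟 (P y)) → 𝒟 (λ θ → P (f θ) θ)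

  simple-const : {Y : Set y} (y : Y) → Simple (λ _ → y)
  simple-const y P p = p y

  simple-map : {Y : Set y} {Z : Set z} {f : Θ → Y} (g : Y → Z) → Simple f → Simple (g ∘ f)
  simple-map g sf P p = sf (P ∘ g) (p ∘ g)

  -- The family `P` in `Simple` may depend on `θ`, so `g θ` can stay inside the predicate while
  -- `f θ` is replaced by a fixed value.
  simple-zip : {X : Set x} {Y : Set y} {Z : Set z} {f : Θ → X} {g : Θ → Y} (h : X → Y → Z) →
               Simple f → Simple g → Simple (λ θ → h (f θ) (g θ))
  simple-zip {g = g} h sf sg P p =
    sf (λ x θ → P (h x (g θ)) θ) λ x → sg (λ y → P (h x y)) λ y → p (h x y)

  simple-mapVec : {X : Set x} {Y : Set y} {f : Θ → X → Y} → (∀ x → Simple (λ θ → f θ x)) →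
                  (xs : Vec X k) → Simple (λ θ → map (f θ) xs)
  simple-mapVec sf []       = simple-const []
  simple-mapVec sf (x ∷ xs) = simple-zip _∷_ (sf x) (simple-mapVec sf xs)

  -- The structure may vary with `θ`, so the same induction serves for `M` and for the fibre over a
  -- varying parameter.
  qf-∈ : {L : Language ℓ} (A : Θ → Structure L c) (val : ∀ θ → Vec (Carrier (A θ)) n) →
         (∀ x y → 𝒟 (λ θ → lookup (val θ) x ≡ lookup (val θ) y)) →
         (∀ R xs → 𝒟 (λ θ → rel (A θ) R (map (lookup (val θ)) xs))) →
         {ψ : Formula L n} → QuantifierFree ψ → 𝒟 (λ θ → A θ ⊨ ψ [ val θ ])
  qf-∈ A val eq-∈ rel-∈ qf-⊥          = falsum
  qf-∈ A val eq-∈ rel-∈ (qf-≈ x y)    = eq-∈ x y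
  qf-∈ A val eq-∈ rel-∈ (qf-rel R xs) = rel-∈ R xs
  qf-∈ A val eq-∈ rel-∈ (qf-∧ p q)    = qf-∈ A val eq-∈ rel-∈ p and qf-∈ A val eq-∈ rel-∈ q
  qf-∈ A val eq-∈ rel-∈ (qf-∨ p q)    = qf-∈ A val eq-∈ rel-∈ p or qf-∈ A val eq-∈ rel-∈ q
  qf-∈ A val eq-∈ rel-∈ (qf-⇒ p q)    = qf-∈ A val eq-∈ rel-∈ p imp qf-∈ A val eq-∈ rel-∈ q

  module _ (em : ExcludedMiddle c) where

    const-∈ : (A : Set c) → 𝒟 (λ _ → A)
    const-∈ A with em {A}
    ... | yes a = resp (λ θ → mk⇔ (λ _ → a) (λ _ h → h)) (falsum imp falsum)
    ... | no ¬a = resp (λ θ → mk⇔ ⊥-elim (λ a → contradiction a ¬a)) falsum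

    -- Case distinction: the value is `true` on `P` and `false` on its negation, and both predicates
    -- lie in `𝒟`.
    simple-em : ∀ {P} → 𝒟 P → Simple (λ θ → does (em {P θ}))
    simple-em {P} p Q q =
      resp (λ θ → split θ em) ((p and q true) or (neg p and q false))
      where
      split : ∀ θ (P? : Dec (P θ)) → ((P θ × Q true θ) ⊎ (¬ P θ × Q false θ)) ⇔ Q (does P?) θ
      split θ (yes a) = mk⇔ (λ { (inj₁ (_ , h)) → h ; (inj₂ (¬a , _)) → contradiction a ¬a })
                            (λ h → inj₁ (a , h))
      split θ (no ¬a) = mk⇔ (λ { (inj₁ (a , _)) → contradiction a ¬a ; (inj₂ (_ , h)) → h })
                            (λ h → inj₂ (¬a , h))

-- Quantifier-free definable predicates

module _ {L : Language ℓ} (A : Structure L c) where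

  QFDefinable : Pred (Vec (Carrier A) n) c → Set (ℓ ⊔ c)
  QFDefinable {n} P = Σ[ ψ ∈ Formula L n ] (QuantifierFree ψ × (∀ v → P v ⇔ (A ⊨ ψ [ v ])))

  qf-definable : {ψ : Formula L n} → QuantifierFree ψ → QFDefinable (A ⊨ ψ [_])
  qf-definable {ψ = ψ} q = ψ , q , λ v → ⇔-id _

  -- One of the two classes to which `Reduction` is applied; the other is `Definable` in `NewFibre`.
  QFDefinable-booleanClass : BooleanClass (QFDefinable {n})
  QFDefinable-booleanClass = record
    { resp   = λ { e (ψ , q , f) → ψ , q , λ v → f v ⇔-∘ ⇔-sym (e v) }
    ; falsum = qf-definable qf-⊥
    ; _and_  = λ { (ψ , q , f) (ψ′ , q′ , f′) → ψ ∧′ ψ′ , qf-∧ q q′ , λ v → f v ×-⇔ f′ v }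
    ; _or_   = λ { (ψ , q , f) (ψ′ , q′ , f′) → ψ ∨′ ψ′ , qf-∨ q q′ , λ v → f v ⊎-⇔ f′ v }
    ; _imp_  = λ { (ψ , q , f) (ψ′ , q′ , f′) → ψ ⇒′ ψ′ , qf-⇒ q q′ , λ v → →-cong-⇔ (f v) (f′ v) }
    }

-- Relations of the product on transversal tuples and on fibres

module _ {L : Language ℓ} (M : Structure L c) (𝔑 : Carrier M → Structure L c) where

  proj₁-lookup : ∀ {a} (bs : Vec (Carrier (𝔑 a)) k) i →
                 proj₁ (lookup (map {B = LexCarrier M 𝔑} (a ,_) bs) i) ≡ a
  proj₁-lookup bs i = cong proj₁ (lookup-map i _ bs)

  -- A tuple `map (a ,_) bs` has constant first coordinates, which excludes the first disjunct of
  -- `LexRel`. Since `i` and `j` come unordered, they are sorted to meet `i < j`.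
  lex-transversal : ∀ R w i j → proj₁ (lookup w i) ≢ proj₁ (lookup w j) →
                    LexRel M 𝔑 (base R) w ⇔ rel M R (map proj₁ w)
  lex-transversal R w i j i≢j = mk⇔ f (λ h → inj₂ (ordered , h))
    where
    f : LexRel M 𝔑 (base R) w → rel M R (map proj₁ w)
    f (inj₁ (a , bs , refl , _)) =
      contradiction (trans (proj₁-lookup bs i) (sym (proj₁-lookup bs j))) i≢j
    f (inj₂ (_ , h)) = h
    ordered : ∃[ i ] ∃[ j ] (i < j × proj₁ (lookup w i) ≢ proj₁ (lookup w j))
    ordered with <-cmp i j
    ... | tri< i<j _ _  = i , j , i<j , i≢j
    ... | tri≈ _ refl _ = contradiction refl i≢j
    ... | tri> _ _ j<i  = j , i , j<i , i≢j ∘ sym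

  pair-injective : ∀ {a} (bs bs′ : Vec (Carrier (𝔑 a)) k) →
                   map {B = LexCarrier M 𝔑} (a ,_) bs ≡ map (a ,_) bs′ → bs ≡ bs′
  pair-injective []       []         _ = refl
  pair-injective (b ∷ bs) (b′ ∷ bs′) e with ∷-injective e
  ... | refl , e′ = cong (b ∷_) (pair-injective bs bs′ e′)

  -- The position `p` determines the fibre. For a nullary `R` the empty tuple belongs to every
  -- fibre, and `base R` says only that `R` holds in some fibre.
  lex-fibre : ∀ R → Fin (arity L R) → ∀ {a w} bs → w ≡ map (a ,_) bs →
              LexRel M 𝔑 (base R) w ⇔ rel (𝔑 a) R bs
  lex-fibre R p {a} bs refl = mk⇔ f (λ h → inj₁ (a , bs , refl , h))
    where
    f : LexRel M 𝔑 (base R) (map (a ,_) bs) → rel (𝔑 a) R bs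
    f (inj₁ (a′ , bs′ , e , h))
      with trans (sym (proj₁-lookup bs p))
                 (trans (cong (λ w → proj₁ (lookup w p)) e) (proj₁-lookup bs′ p))
    ... | refl = subst (rel (𝔑 a) R) (sym (pair-injective bs bs′ e)) h
    f (inj₂ ((i , j , _ , i≢j) , _)) =
      contradiction (trans (proj₁-lookup bs i) (sym (proj₁-lookup bs j))) i≢j

-- Reduction of quantifier-free formulas to a single fibre

≡⇒⇔ : {A B : Set c} → A ≡ B → A ⇔ B
≡⇒⇔ refl = ⇔-id _

≡-cong₂-⇔ : {A : Set x} {a a′ b b′ : A} → a ≡ a′ → b ≡ b′ → (a ≡ b) ⇔ (a′ ≡ b′)
≡-cong₂-⇔ refl refl = ⇔-id _

truth-⇔ : {L : Language ℓ} (A : Structure L c) {v : Vec (Carrier A) n} {P : Set c} (P? : Dec P) →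
          P ⇔ (A ⊨ truth (does P?) [ v ])
truth-⇔ A (yes p) = mk⇔ (λ _ h → h) (λ _ → p)
truth-⇔ A (no ¬p) = mk⇔ (λ p → contradiction p ¬p) ⊥-elim

lookup-pair : {A : Set x} {a b : A} → a ≡ b → ∀ i → lookup (a ∷ b ∷ []) i ≡ a
lookup-pair refl zero       = refl
lookup-pair refl (suc zero) = refl

-- Separates the atoms that omit the bound variable `zero` from those that contain it. In the
-- latter, `p` witnesses that the tuple meets the fibre of the quantified element.
unsuc : (xs : Vec (Fin (suc n)) k) →
        (Σ[ xs′ ∈ Vec (Fin n) k ] xs ≡ map suc xs′) ⊎ (∃[ p ] lookup xs p ≡ zero)
unsuc []           = inj₁ ([] , refl)
unsuc (zero  ∷ xs) = inj₂ (zero , refl)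
unsuc (suc x ∷ xs) with unsuc xs
... | inj₁ (xs′ , e) = inj₁ (x ∷ xs′ , cong (suc x ∷_) e)
... | inj₂ (p , e)   = inj₂ (suc p , e)

collect : {A : Set x} → Vec (Maybe A) k → Maybe (Vec A k)
collect []       = just []
collect (q ∷ qs) = Maybe.zipWith _∷_ q (collect qs)

module _ {L : Language ℓ} (M : Structure L c) (𝔑 : Carrier M → Structure L c) where

  private
    Lex : Structure (LexLanguage L) c
    Lex = LexProduct M 𝔑

  fibre-≡ : ∀ {a} {b b′ : Carrier (𝔑 a)} {x y : Carrier Lex} →
            x ≡ (a , b) → y ≡ (a , b′) → (x ≡ y) ⇔ (b ≡ b′)
  fibre-≡ refl refl = mk⇔ (λ { refl → refl }) (λ { refl → refl })

  -- An element over `a` that is missing from `l` fits neither constructor, so `l` has to list every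
  -- parameter that lies in the fibre.
  data Locates {a} (l : Vec (Carrier (𝔑 a)) m) (x : Carrier Lex) : Maybe (Fin m) → Set c where
    inside  : ∀ y → x ≡ (a , lookup l y) → Locates l x (just y)
    outside : proj₁ x ≢ a → Locates l x nothing

  weaken-Locates : ∀ {a b} {l : Vec (Carrier (𝔑 a)) m} {x q} →
                   Locates l x q → Locates (b ∷ l) x (Maybe.map suc q)
  weaken-Locates (inside y e)  = inside (suc y) e
  weaken-Locates (outside x≢a) = outside x≢a

  data LocatesAll {a} (l : Vec (Carrier (𝔑 a)) m) (w : Vec (Carrier Lex) k) :
                  Maybe (Vec (Fin m) k) → Set c where
    inside  : ∀ ys → w ≡ map (a ,_) (map (lookup l) ys) → LocatesAll l w (just ys)
    outside : ∀ p → proj₁ (lookup w p) ≢ a → LocatesAll l w nothing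

  collect-Locates : ∀ {a} {l : Vec (Carrier (𝔑 a)) m} (w : Vec (Carrier Lex) k) qs →
                    (∀ p → Locates l (lookup w p) (lookup qs p)) → LocatesAll l w (collect qs)
  collect-Locates []      []       h = inside [] refl
  collect-Locates (x ∷ w) (q ∷ qs) h
    with q | collect qs | h zero | collect-Locates w qs (h ∘ suc)
  ... | _ | _ | inside y refl | inside ys refl = inside (y ∷ ys) refl
  ... | _ | _ | inside _ _    | outside p p≢a  = outside (suc p) p≢a
  ... | _ | _ | outside x≢a   | _              = outside zero x≢a

  -- An element (a , b) is to be quantified, where a is pt θ and b varies. Of
  -- the parameters env θ, those in the fibre over a are found in loc θ, at the
  -- positions given by r θ.
  module Reduction
    {t d : Level} {n m : ℕ} (em : ExcludedMiddle c)
    {Θ : Set t} {𝒟 : Pred Θ c → Set d} (bc : BooleanClass 𝒟)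
    (pt : Θ → Carrier M) (env : Θ → Vec (Carrier Lex) n)
    (loc : (θ : Θ) → Vec (Carrier (𝔑 (pt θ))) m)
    (r : Θ → Vec (Maybe (Fin m)) n) (r-simple : BooleanClass.Simple bc r)
    (r-locates : ∀ θ j → Locates (loc θ) (lookup (env θ) j) (lookup (r θ) j))
    (lex-∈ : ∀ {ψ} → QuantifierFree ψ → 𝒟 (λ θ → Lex ⊨ ψ [ env θ ]))
    (base-∈ : ∀ φ → 𝒟 (λ θ → M ⊨ φ [ pt θ ∷ map proj₁ (env θ) ]))
    (fibre-∈ : ∀ χ → 𝒟 (λ θ → 𝔑 (pt θ) ⊨ χ [ loc θ ]))
    where

    open BooleanClass bc

    private
      u : (θ : Θ) → Carrier (𝔑 (pt θ)) → Vec (Carrier Lex) (suc n)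
      u θ b = (pt θ , b) ∷ env θ

      r⁺ : Vec (Maybe (Fin m)) n → Vec (Maybe (Fin (suc m))) (suc n)
      r⁺ q = just zero ∷ map (Maybe.map suc) q

      r⁺-locates : ∀ θ b x → Locates (b ∷ loc θ) (lookup (u θ b) x) (lookup (r⁺ (r θ)) x)
      r⁺-locates θ b zero    = inside zero refl
      r⁺-locates θ b (suc j) =
        subst (Locates _ _) (sym (lookup-map j _ (r θ))) (weaken-Locates (r-locates θ j))

      collected : Vec (Maybe (Fin m)) n → Vec (Fin (suc n)) k → Maybe (Vec (Fin (suc m)) k)
      collected q xs = collect (map (lookup (r⁺ q)) xs)

      collected-locates : ∀ θ b (xs : Vec (Fin (suc n)) k) →
                          LocatesAll (b ∷ loc θ) (map (lookup (u θ b)) xs) (collected (r θ) xs)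
      collected-locates θ b xs = collect-Locates _ (map (lookup (r⁺ (r θ))) xs) λ p →
        subst₂ (Locates _) (sym (lookup-map p (lookup (u θ b)) xs))
                           (sym (lookup-map p (lookup (r⁺ (r θ))) xs))
                           (r⁺-locates θ b (lookup xs p))

      proj₁-u : ∀ θ b x → proj₁ (lookup (u θ b) x) ≡ lookup (pt θ ∷ map proj₁ (env θ)) x
      proj₁-u θ b x = sym (lookup-map x proj₁ (u θ b))

      at-zero : ∀ θ b (xs : Vec (Fin (suc n)) k) p → lookup xs p ≡ zero →
                proj₁ (lookup (map (lookup (u θ b)) xs) p) ≡ pt θ
      at-zero θ b xs p p≡0 =
        cong proj₁ (trans (lookup-map p _ xs) (cong (lookup (u θ b)) p≡0))

    Reduced : Formula (LexLanguage L) (suc n) → Set (ℓ ⊔ t ⊔ lsuc c ⊔ d)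
    Reduced ψ =
      Σ[ f ∈ (Θ → Formula L (suc m)) ]
        (Simple f × (∀ θ b → (Lex ⊨ ψ [ u θ b ]) ⇔ (𝔑 (pt θ) ⊨ f θ [ b ∷ loc θ ])))

    -- As `P` does not mention `b`, the atom can be replaced by a truth value that depends on `θ`
    -- alone.
    external : ∀ ψ {P} → 𝒟 P → (∀ θ b → (Lex ⊨ ψ [ u θ b ]) ⇔ P θ) → Reduced ψ
    external ψ {P} p e =
      (λ θ → truth (does (em {P θ}))) , simple-map truth (simple-em em p) ,
      λ θ b → truth-⇔ (𝔑 (pt θ)) em ⇔-∘ e θ b

    reduce-≈ : ∀ x y → Reduced (x ≈′ y)
    reduce-≈ x y with unsuc (x ∷ y ∷ [])
    ... | inj₁ (x′ ∷ y′ ∷ [] , refl) = external (x ≈′ y) (lex-∈ (qf-≈ x′ y′)) (λ θ b → ⇔-id _)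
    ... | inj₂ (p , p≡0) = f ∘ r , simple-map f r-simple , correct
      where
      same : Maybe (Vec (Fin (suc m)) 2) → Formula L (suc m)
      same (just (x₁ ∷ y₁ ∷ [])) = x₁ ≈′ y₁
      same nothing               = ⊥′
      f : Vec (Maybe (Fin m)) n → Formula L (suc m)
      f q = same (collected q (x ∷ y ∷ []))
      correct : ∀ θ b → (Lex ⊨ x ≈′ y [ u θ b ]) ⇔ (𝔑 (pt θ) ⊨ f (r θ) [ b ∷ loc θ ])
      correct θ b with collected (r θ) (x ∷ y ∷ []) | collected-locates θ b (x ∷ y ∷ [])
      ... | _ | inside (x₁ ∷ y₁ ∷ []) e =
        fibre-≡ (∷-injectiveˡ e) (∷-injectiveˡ (∷-injectiveʳ e))
      -- Equality would put both sides into the fibre over `pt θ`, because the side at `p` is the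
      -- bound variable.
      ... | _ | outside q q≢a = mk⇔ (λ h → contradiction (in-fibre h) q≢a) ⊥-elim
        where
        in-fibre : lookup (u θ b) x ≡ lookup (u θ b) y →
                   proj₁ (lookup (map (lookup (u θ b)) (x ∷ y ∷ [])) q) ≡ pt θ
        in-fibre h = trans (cong proj₁ (trans (lookup-pair h q) (sym (lookup-pair h p))))
                           (at-zero θ b (x ∷ y ∷ []) p p≡0)

    reduce-rel : ∀ R xs → Reduced (rel′ R xs)
    reduce-rel s (x ∷ y ∷ []) =
      external (rel′ s (x ∷ y ∷ [])) (base-∈ (x ≈′ y)) λ θ b →
        ≡-cong₂-⇔ (proj₁-u θ b x) (proj₁-u θ b y)
    reduce-rel (R ᵁ) (x ∷ []) =
      external (rel′ (R ᵁ) (x ∷ [])) (base-∈ (rel′ R (replicate _ x))) λ θ b →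
        ≡⇒⇔ (cong (rel M R) (trans (cong (replicate _) (proj₁-u θ b x)) (sym (map-replicate _ x _))))
    reduce-rel (base R) xs with unsuc xs
    ... | inj₁ (xs′ , refl) =
      external (rel′ (base R) xs) (lex-∈ (qf-rel (base R) xs′)) λ θ b →
        ≡⇒⇔ (cong (LexRel M 𝔑 (base R)) (sym (map-∘ (lookup (u θ b)) suc xs′)))
    -- The bound variable stands at `p`. The tuple therefore either lies in the fibre over `pt θ`
    -- and is read there, or is transversal and is decided in `M` by `B`.
    ... | inj₂ (p , p≡0) =
      (λ θ → f (r θ) (does (em {B θ}))) ,
      simple-zip f r-simple (simple-em em (base-∈ (rel′ R xs))) ,
      correct
      where
      B : Pred Θ c
      B θ = M ⊨ rel′ R xs [ pt θ ∷ map proj₁ (env θ) ]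
      g : Maybe (Vec (Fin (suc m)) (arity L R)) → Bool → Formula L (suc m)
      g (just ys) _  = rel′ R ys
      g nothing   β = truth β
      f : Vec (Maybe (Fin m)) n → Bool → Formula L (suc m)
      f q = g (collected q xs)
      correct : ∀ θ b → (Lex ⊨ rel′ (base R) xs [ u θ b ]) ⇔
                        (𝔑 (pt θ) ⊨ f (r θ) (does (em {B θ})) [ b ∷ loc θ ])
      correct θ b with collected (r θ) xs | collected-locates θ b xs
      ... | _ | inside ys e = lex-fibre M 𝔑 R p _ e
      ... | _ | outside q q≢a =
        truth-⇔ (𝔑 (pt θ)) em ⇔-∘
        (≡⇒⇔ (cong (rel M R) (sym (map-lookup-map proj₁ (u θ b) xs))) ⇔-∘
         lex-transversal M 𝔑 R _ q p (subst (_ ≢_) (sym (at-zero θ b xs p p≡0)) q≢a))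

    reduce : ∀ {ψ} → QuantifierFree ψ → Reduced ψ
    reduce qf-⊥          = (λ _ → ⊥′) , simple-const ⊥′ , λ θ b → ⇔-id _
    reduce (qf-≈ x y)    = reduce-≈ x y
    reduce (qf-rel R xs) = reduce-rel R xs
    reduce (qf-∧ p q)    =
      let f , sf , ef = reduce p; g , sg , eg = reduce q in
      _ , simple-zip _∧′_ sf sg , λ θ b → ef θ b ×-⇔ eg θ b
    reduce (qf-∨ p q)    =
      let f , sf , ef = reduce p; g , sg , eg = reduce q in
      _ , simple-zip _∨′_ sf sg , λ θ b → ef θ b ⊎-⇔ eg θ b
    reduce (qf-⇒ p q)    =
      let f , sf , ef = reduce p; g , sg , eg = reduce q in
      _ , simple-zip _⇒′_ sf sg , λ θ b → →-cong-⇔ (ef θ b) (eg θ b)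

    fibre-∃-∈ : ∀ {ψ} → QuantifierFree ψ →
                𝒟 (λ θ → Σ[ b ∈ Carrier (𝔑 (pt θ)) ] (Lex ⊨ ψ [ (pt θ , b) ∷ env θ ]))
    fibre-∃-∈ q =
      let f , sf , e = reduce q in
      resp (λ θ → mk⇔ (λ (b , h) → b , from (e θ b) h) (λ (b , h) → b , to (e θ b) h))
           -- For each value `χ` of `f`, the quantifier moves into the fibre as `∃′ χ`, which
           -- `fibre-∈` covers.
           (sf (λ χ θ → 𝔑 (pt θ) ⊨ ∃′ χ [ loc θ ]) (λ χ → fibre-∈ (∃′ χ)))

-- Translation of formulas on first coordinates into the product

module _ (em : ExcludedMiddle c) {L : Language ℓ}
  (M : Structure L c) (𝔑 : Carrier M → Structure L c) (qeM : EliminatesQuantifiers M)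
  where

  private
    Lex : Structure (LexLanguage L) c
    Lex = LexProduct M 𝔑

    module QM {n} = BooleanClass (QFDefinable-booleanClass M {n = n})
    open module QLex {n} = BooleanClass (QFDefinable-booleanClass Lex {n = n})

  proj : Vec (Carrier Lex) n → Fin n → Carrier M
  proj v x = proj₁ (lookup v x)

  proj-allFin : (v : Vec (Carrier Lex) n) → map (proj v) (allFin n) ≡ map proj₁ v
  proj-allFin v = trans (map-∘ proj₁ (lookup v) (allFin _)) (cong (map proj₁) (map-lookup-allFin v))

  proj-≡-definable : (x y : Fin n) → QFDefinable Lex (λ v → proj v x ≡ proj v y)
  proj-≡-definable x y = qf-definable Lex (qf-rel s (x ∷ y ∷ []))

  -- If the first coordinates all agree, `R ᵁ` tests them; otherwise the tuple is transversal, and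
  -- `base R` in the product agrees with `R` in `M`.
  base-rel-definable : ∀ R (ys : Vec (Fin n) (arity L R)) →
                       QFDefinable Lex (λ v → rel M R (map (proj v) ys))
  base-rel-definable R ys with empty-or-inhabited (arity L R)
  -- A nullary `R` does not depend on `v`, so its truth in `M` is a constant.
  ... | inj₁ nullary =
    resp (λ v → ≡⇒⇔ (cong (rel M R) (empty-unique nullary _ _)))
         (const-∈ em (rel M R (subst (Vec (Carrier M)) (sym nullary) [])))
  ... | inj₂ p =
    resp correct
      ((same and qf-definable Lex (qf-rel (R ᵁ) (lookup ys p ∷ []))) or
       (neg same and qf-definable Lex (qf-rel (base R) ys)))
    where
    Same : Vec (Carrier Lex) _ → Set c
    Same v = ∀ q → proj v (lookup ys q) ≡ proj v (lookup ys p)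
    same : QFDefinable Lex Same
    same = all-Fin λ q → proj-≡-definable (lookup ys q) (lookup ys p)
    constant : ∀ v → Same v → replicate _ (proj v (lookup ys p)) ≡ map (proj v) ys
    constant v h = sym (map-constant _ ys h)
    transversal : ∀ v → ¬ Same v →
                  LexRel M 𝔑 (base R) (map (lookup v) ys) ⇔ rel M R (map (proj v) ys)
    transversal v ¬h with ¬∀⟶∃¬ _ _ (λ _ → em) ¬h
    ... | q , q≢p = ≡⇒⇔ (cong (rel M R) (sym (map-∘ proj₁ (lookup v) ys))) ⇔-∘
      lex-transversal M 𝔑 R _ q p λ e →
        q≢p (trans (sym (cong proj₁ (lookup-map q (lookup v) ys)))
                   (trans e (cong proj₁ (lookup-map p (lookup v) ys))))
    correct : ∀ v → ((Same v × rel M R (replicate _ (proj v (lookup ys p)))) ⊎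
                     (¬ Same v × LexRel M 𝔑 (base R) (map (lookup v) ys))) ⇔
                    rel M R (map (proj v) ys)
    correct v = mk⇔
      (λ { (inj₁ (h , r))  → subst (rel M R) (constant v h) r
         ; (inj₂ (¬h , r)) → to (transversal v ¬h) r })
      (λ r → case em of λ
        { (yes h) → inj₁ (h , subst (rel M R) (sym (constant v h)) r)
        ; (no ¬h) → inj₂ (¬h , from (transversal v ¬h) r) })

  -- After `qeM` only atoms remain: equality of first coordinates is `s`, and relations are covered
  -- by `base-rel-definable`.
  base-definable : (φ : Formula L k) (xs : Vec (Fin n) k) →
                   QFDefinable Lex (λ v → M ⊨ φ [ map (proj v) xs ])
  base-definable φ xs with qeM φ
  ... | ψ , q , e =
    resp (λ v → ⇔-sym (e _)) (qf-∈ (λ _ → M) (λ v → map (proj v) xs)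
      (λ x y → resp (λ v → ≡-cong₂-⇔ (sym (lookup-map x _ xs)) (sym (lookup-map y _ xs)))
                    (proj-≡-definable (lookup xs x) (lookup xs y)))
      (λ R ys → resp (λ v → ≡⇒⇔ (cong (rel M R) (sym (map-lookup-map (proj v) xs ys))))
                     (base-rel-definable R (map (lookup xs) ys)))
      q)

  module _ (sent : ∀ φ → ∅-Definable M (λ a → 𝔑 a ⊨ φ)) where

    sentence-definable : ∀ φ (x : Fin n) → QFDefinable Lex (λ v → 𝔑 (proj v x) ⊨ φ)
    sentence-definable φ x with sent φ
    ... | φ* , e = resp (λ v → ⇔-sym (e (proj v x))) (base-definable φ* (x ∷ []))

    -- Witnesses in the fibre of a parameter

    module OldFibre (uqe : UniformlyEliminatesQuantifiers 𝔑) {n : ℕ} (i : Fin n) where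

      sameFibre : Vec (Carrier Lex) n → Fin n → Bool
      sameFibre v j = does (em {proj v j ≡ proj v i})

      sameFibre-simple : ∀ j → Simple (λ v → sameFibre v j)
      sameFibre-simple j = simple-em em (proj-≡-definable j i)

      choose : {x y : Carrier Lex} → Dec (proj₁ x ≡ proj₁ y) → Carrier (𝔑 (proj₁ y))
      choose {x} (yes e)   = subst (Carrier ∘ 𝔑) e (proj₂ x)
      choose {y = y} (no _) = proj₂ y

      -- Parameters outside the fibre of the i-th one are replaced by the i-th one.
      loc : (v : Vec (Carrier Lex) n) → Vec (Carrier (𝔑 (proj v i))) n
      loc v = tabulate λ j → choose {lookup v j} {lookup v i} em

      -- Names each entry of `loc v` by a variable of `v`, so that atoms about `loc v` in the fibre
      -- become atoms of the product.
      index : Vec (Carrier Lex) n → Fin n → Fin n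
      index v j = if sameFibre v j then j else i

      index-simple : ∀ j → Simple (λ v → index v j)
      index-simple j = simple-map (if_then j else i) (sameFibre-simple j)

      lookup-index : ∀ v j → lookup v (index v j) ≡ (proj v i , lookup (loc v) j)
      lookup-index v j =
        trans (pick em) (cong (proj v i ,_) (sym (lookup∘tabulate _ j)))
        where
        pick : (d : Dec (proj v j ≡ proj v i)) →
               lookup v (if does d then j else i) ≡ (proj v i , choose {lookup v j} {lookup v i} d)
        pick (yes e) = unpack e
          where
          unpack : {x : Carrier Lex} {a : Carrier M} (e : proj₁ x ≡ a) →
                   x ≡ (a , subst (Carrier ∘ 𝔑) e (proj₂ x))
          unpack refl = refl
        pick (no _)  = refl

      -- For a parameter outside the fibre, `loc` holds only a default; `nothing` prevents this
      -- default from being taken for the parameter.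
      locate : Vec (Carrier Lex) n → Vec (Maybe (Fin n)) n
      locate v = map (λ j → if sameFibre v j then just j else nothing) (allFin n)

      locate-simple : Simple locate
      locate-simple =
        simple-mapVec (λ j → simple-map (if_then just j else nothing) (sameFibre-simple j)) (allFin n)

      locate-locates : ∀ v j → Locates M 𝔑 (loc v) (lookup v j) (lookup (locate v) j)
      locate-locates v j =
        subst (Locates M 𝔑 (loc v) (lookup v j))
              (sym (trans (lookup-map j _ (allFin n)) (cong tag (lookup-allFin j)))) tagged
        where
        tag : Fin n → Maybe (Fin n)
        tag j = if sameFibre v j then just j else nothing
        tagged : Locates M 𝔑 (loc v) (lookup v j) (tag j)
        tagged with em {proj v j ≡ proj v i} | lookup-index v j
        ... | yes _  | e = inside j e
        ... | no j≢i | _ = outside j≢i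

      fibre-rel-definable : ∀ R xs →
                            QFDefinable Lex (λ v → rel (𝔑 (proj v i)) R (map (lookup (loc v)) xs))
      fibre-rel-definable R xs with empty-or-inhabited (arity L R)
      -- A nullary `R` is a sentence about the fibre, so it is expressed through `M`.
      ... | inj₁ nullary =
        resp (λ v → ≡⇒⇔ (cong (rel (𝔑 (proj v i)) R) (empty-unique nullary _ _)))
             (sentence-definable (rel′ R (subst (Vec (Fin 0)) (sym nullary) [])) i)
      ... | inj₂ p =
        resp (λ v → lex-fibre M 𝔑 R p _ (indexed v))
             (simple-mapVec index-simple xs (λ ys v → LexRel M 𝔑 (base R) (map (lookup v) ys))
               (λ ys → qf-definable Lex (qf-rel (base R) ys)))
        where
        indexed : ∀ v → map (lookup v) (map (index v) xs) ≡
                        map (proj v i ,_) (map (lookup (loc v)) xs)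
        indexed v = trans (sym (map-∘ _ _ xs)) (trans (map-cong (lookup-index v) xs) (map-∘ _ _ xs))

      fibre-qf-definable : ∀ {χ} → QuantifierFree χ →
                           QFDefinable Lex (λ v → 𝔑 (proj v i) ⊨ χ [ loc v ])
      fibre-qf-definable = qf-∈ (λ v → 𝔑 (proj v i)) loc
        (λ x y → resp (λ v → fibre-≡ M 𝔑 (lookup-index v x) (lookup-index v y))
          (simple-zip _,_ (index-simple x) (index-simple y)
            (λ (x , y) v → lookup v x ≡ lookup v y) (λ (x , y) → qf-definable Lex (qf-≈ x y))))
        fibre-rel-definable

      -- The fibre is a model of the common theory, so some candidate `χs j` is equivalent to `χ` in
      -- it. That equivalence, universally closed, is a sentence; hence its truth for a given `j` is
      -- quantifier-free definable, and `χs j` can be used where it holds.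
      fibre-definable : ∀ χ → QFDefinable Lex (λ v → 𝔑 (proj v i) ⊨ χ [ loc v ])
      fibre-definable χ with uqe χ
      ... | k , χs , qf , h =
        resp (λ v → mk⇔
               (λ { (j , σ , g) → from (equivalent v j σ) g })
               (λ g → case h (𝔑 (proj v i)) (λ σ σ∈ → σ∈ (proj v i)) of λ
                 { (j , e) → j ,
                     from (close-⇔ (𝔑 (proj v i)) (χ⇔χs j)) (λ w → to (e w) , from (e w)) ,
                     to (e (loc v)) g }))
             (any-Fin λ j → sentence-definable (close (χ⇔χs j)) i and fibre-qf-definable (qf j))
        where
        χ⇔χs : Fin k → Formula L n
        χ⇔χs j = (χ ⇒′ χs j) ∧′ (χs j ⇒′ χ)
        equivalent : ∀ v j → 𝔑 (proj v i) ⊨ close (χ⇔χs j) →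
                     (𝔑 (proj v i) ⊨ χ [ loc v ]) ⇔ (𝔑 (proj v i) ⊨ χs j [ loc v ])
        equivalent v j σ with to (close-⇔ (𝔑 (proj v i)) (χ⇔χs j)) σ (loc v)
        ... | f , g = mk⇔ f g

      ∃-definable : ∀ {ψ} → QuantifierFree ψ →
                    QFDefinable Lex (λ v → Σ[ b ∈ Carrier (𝔑 (proj v i)) ] (Lex ⊨ ψ [ (proj v i , b) ∷ v ]))
      ∃-definable = Reduction.fibre-∃-∈ M 𝔑 em (QFDefinable-booleanClass Lex)
        (λ v → proj v i) (λ v → v) loc locate locate-simple locate-locates (qf-definable Lex)
        (λ φ → resp (λ v → ≡⇒⇔ (cong (λ w → M ⊨ φ [ proj v i ∷ w ]) (proj-allFin v)))
                    (base-definable φ (i ∷ allFin n)))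
        fibre-definable

    -- Witnesses in a fibre without parameters

    module NewFibre {n : ℕ} where

      Θ : Set c
      Θ = Σ[ (a , v) ∈ Carrier M × Vec (Carrier Lex) n ] (∀ j → proj v j ≢ a)

      -- What cannot be said in M, namely conditions on v in the product, goes into
      -- the choice of the formula.
      Definable : Pred Θ c → Set (ℓ ⊔ lsuc c)
      Definable P =
        Σ[ f ∈ (Vec (Carrier Lex) n → Formula L (suc n)) ]
          (Simple f × (∀ (θ@((a , v) , _) : Θ) → P θ ⇔ (M ⊨ f v [ a ∷ map proj₁ v ])))

      booleanClass : BooleanClass Definable
      booleanClass = record
        { resp   = λ { e (f , sf , ef) → f , sf , λ θ → ef θ ⇔-∘ ⇔-sym (e θ) }
        ; falsum = _ , simple-const ⊥′ , λ θ → ⇔-id _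
        ; _and_  = λ { (f , sf , ef) (g , sg , eg) → _ , simple-zip _∧′_ sf sg , λ θ → ef θ ×-⇔ eg θ }
        ; _or_   = λ { (f , sf , ef) (g , sg , eg) → _ , simple-zip _∨′_ sf sg , λ θ → ef θ ⊎-⇔ eg θ }
        ; _imp_  = λ { (f , sf , ef) (g , sg , eg) →
                       _ , simple-zip _⇒′_ sf sg , λ θ → →-cong-⇔ (ef θ) (eg θ) }
        }

      base-∈ : ∀ φ → Definable (λ ((a , v) , _) → M ⊨ φ [ a ∷ map proj₁ v ])
      base-∈ φ = _ , simple-const φ , λ θ → ⇔-id _

      lex-∈ : ∀ {ψ} → QuantifierFree ψ → Definable (λ ((_ , v) , _) → Lex ⊨ ψ [ v ])
      lex-∈ q = _ , simple-map truth (simple-em em (qf-definable Lex q)) , λ θ → truth-⇔ M em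

      -- Renames the only variable of `ψ` to `zero`, because `Definable` evaluates its formulas at
      -- `a ∷ map proj₁ v`.
      head-definable : {ψ : Formula L 1} → QuantifierFree ψ →
                       QFDefinable M (λ (w : Vec (Carrier M) (suc n)) → M ⊨ ψ [ head w ∷ [] ])
      head-definable = QM.qf-∈ (λ _ → M) (λ w → head w ∷ [])
        (λ { zero zero → QM.resp (λ w → mk⇔ (λ _ → refl) (λ _ → refl))
                                 (qf-definable M (qf-≈ zero zero)) })
        (λ R xs → QM.resp (λ w → ≡⇒⇔ (cong (rel M R) (heads w xs)))
                          (qf-definable M (qf-rel R (replicate _ zero))))
        where
        only-zero : ∀ (w : Vec (Carrier M) (suc n)) x → lookup (head w ∷ []) x ≡ head w
        only-zero w zero = refl
        heads : ∀ w (xs : Vec (Fin 1) k) →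
                map (lookup w) (replicate k zero) ≡ map (lookup (head w ∷ [])) xs
        heads w@(_ ∷ _) xs =
          trans (map-replicate (lookup w) zero _)
                (sym (map-constant _ xs λ i → only-zero w (lookup xs i)))

      -- The sentence becomes a formula about `a` in `M`; `qeM` makes it quantifier-free, the form
      -- in which `head-definable` can rename its variable.
      fibre-∈ : ∀ φ → Definable (λ ((a , _) , _) → 𝔑 a ⊨ φ)
      fibre-∈ φ with sent φ
      ... | φ* , e with qeM φ*
      ... | ψ , q , e′ with head-definable q
      ... | χ , _ , e″ = BooleanClass.resp booleanClass
        (λ ((a , v) , _) → ⇔-sym (e a) ⇔-∘ (⇔-sym (e′ (a ∷ [])) ⇔-∘ ⇔-sym (e″ (a ∷ map proj₁ v))))
        (base-∈ χ)

      ∃-∈ : ∀ {ψ} → QuantifierFree ψ →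
            Definable (λ ((a , v) , _) → Σ[ b ∈ Carrier (𝔑 a) ] (Lex ⊨ ψ [ (a , b) ∷ v ]))
      ∃-∈ = Reduction.fibre-∃-∈ M 𝔑 em booleanClass
        (λ ((a , _) , _) → a) (λ ((_ , v) , _) → v) (λ _ → [])
        -- By the condition in `Θ` no parameter lies over `a`, so none is located and `loc` is
        -- empty.
        (λ _ → replicate n nothing) (BooleanClass.simple-const booleanClass (replicate n nothing))
        (λ (_ , h) j → subst (Locates M 𝔑 [] _) (sym (lookup-replicate j nothing)) (outside (h j)))
        lex-∈ base-∈ fibre-∈

      distinct : QFDefinable M (λ (w : Vec (Carrier M) (suc n)) →
                   ∀ j → lookup w (suc j) ≢ lookup w zero)
      distinct = QM.all-Fin λ j → QM.neg (qf-definable M (qf-≈ (suc j) zero))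

      ∃-definable : ∀ {ψ} → QuantifierFree ψ →
                    QFDefinable Lex (λ v → Σ[ a ∈ Carrier M ] ((∀ j → proj v j ≢ a) ×
                      (Σ[ b ∈ Carrier (𝔑 a) ] (Lex ⊨ ψ [ (a , b) ∷ v ]))))
      ∃-definable q with distinct | ∃-∈ q
      ... | δ , _ , eδ | f , sf , e =
        resp (λ v → mk⇔
               (λ { (a , d , h) →
                      let new = λ j → from (eδ (a ∷ map proj₁ v)) d j ∘ trans (lookup-map j proj₁ v)
                      in a , new , from (e ((a , v) , new)) h })
               (λ { (a , new , h) → a ,
                      to (eδ (a ∷ map proj₁ v)) (λ j → new j ∘ trans (sym (lookup-map j proj₁ v))) ,
                      to (e ((a , v) , new)) h }))
             -- Once the formula `φ` chosen by `v` is fixed, the quantifier over `a` is a quantifier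
             -- in `M`, and `base-definable` eliminates it. The conjunct `δ` keeps `a` apart from
             -- the first coordinates of `v`.
             (sf (λ φ v → M ⊨ ∃′ (δ ∧′ φ) [ map proj₁ v ]) λ φ →
               resp (λ v → ≡⇒⇔ (cong (λ w → M ⊨ ∃′ (δ ∧′ φ) [ w ]) (proj-allFin v)))
                    (base-definable (∃′ (δ ∧′ φ)) (allFin n)))

    -- Elimination of quantifiers in the product

    module _ (uqe : UniformlyEliminatesQuantifiers 𝔑) where

      -- A witness lies either in the fibre of some parameter or over a point different from all
      -- first coordinates, and each case is definable.
      ∃-definable : {P : Pred (Vec (Carrier Lex) (suc n)) c} → QFDefinable Lex P →
                    QFDefinable Lex (λ v → Σ[ x ∈ Carrier Lex ] P (x ∷ v))
      ∃-definable (ψ , q , e) =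
        resp (λ v → mk⇔
               (λ { (inj₁ (i , b , h)) → _ , from (e _) h
                  ; (inj₂ (a , _ , b , h)) → _ , from (e _) h })
               (λ { ((a , b) , h) → split v a b (to (e _) h) }))
             (any-Fin (λ i → OldFibre.∃-definable uqe i q) or NewFibre.∃-definable q)
        where
        split : ∀ v a b → Lex ⊨ ψ [ (a , b) ∷ v ] →
                (∃[ i ] (Σ[ b ∈ Carrier (𝔑 (proj v i)) ] (Lex ⊨ ψ [ (proj v i , b) ∷ v ]))) ⊎
                (Σ[ a ∈ Carrier M ] ((∀ j → proj v j ≢ a) ×
                  (Σ[ b ∈ Carrier (𝔑 a) ] (Lex ⊨ ψ [ (a , b) ∷ v ]))))
        split v a b h with em {∃[ i ] proj v i ≡ a}
        ... | yes (i , refl) = inj₁ (i , b , h)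
        ... | no new         = inj₂ (a , (λ j e → new (j , e)) , b , h)

      definable : (φ : Formula (LexLanguage L) n) → QFDefinable Lex (Lex ⊨ φ [_])
      definable ⊥′          = falsum
      definable (x ≈′ y)    = qf-definable Lex (qf-≈ x y)
      definable (rel′ R xs) = qf-definable Lex (qf-rel R xs)
      definable (φ ∧′ ψ)    = definable φ and definable ψ
      definable (φ ∨′ ψ)    = definable φ or definable ψ
      definable (φ ⇒′ ψ)    = definable φ imp definable ψ
      definable (∃′ φ)      = ∃-definable (definable φ)
      -- The universal quantifier is treated as `¬ ∃ ¬`, which is classically equivalent.
      definable (∀′ φ)      =
        resp (λ v → mk⇔ (λ h x → decidable-stable em (λ ¬h → h (x , ¬h)))
                        (λ { h (x , ¬h) → ¬h (h x) }))
             (neg (∃-definable (neg (definable φ))))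

theorem2p5 : ∀ {ℓ c} → ExcludedMiddle c →
    (L : Language ℓ) (M : Structure L c) (𝔑 : Carrier M → Structure L c) →
    (∀ (φ : Sentence L) → ∅-Definable M (λ a → 𝔑 a ⊨ φ)) →
    UniformlyEliminatesQuantifiers 𝔑 →
    EliminatesQuantifiers M →
    EliminatesQuantifiers (LexProduct M 𝔑)
theorem2p5 em L M 𝔑 sent uqe qeM = definable em M 𝔑 qeM sent uqe
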